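{- If $G$ is a connected simple chordal graph on $n\ge 2$ vertices with $p$ blocks, then $\mathrm{hn}_{cc}(G)=p+1$.
   Context: A chordal graph is a graph with no induced cycle of length greater than $3$. A block of a graph is a maximal connected subgraph without a cut-vertex. A cycle is a closed walk $(v_1,\dots,v_q,v_1)$ with at least one edge in which the only repeated vertex is $v_1$. For $S\subseteq V(G)$ let $I_{cc}(S)=S\cup\{v\in V(G): \text{there is a cycle } C \text{ of } G \text{ with } V(C)\setminus S=\{v\}\}$. A set $S$ is convex if $I_{cc}(S)=S$; $\mathrm{hull}(S)$ is the smallest convex set containing $S$; $S$ is a hull set if $\mathrm{hull}(S)=V(G)$; $\mathrm{hn}_{cc}(G)$ is the minimum cardinality of a hull set of $G$.
   Formalization: A cycle is required to have at least three distinct vertices; read literally, the definition also admits the closed walk (u,v,u) along one edge, which would give hull number 1 for the complete graph on two vertices instead of p+1 = 2. -}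

module Defs where

open import Data.Nat using (ℕ; zero; suc; _≤_; _+_)
open import Data.Bool using (Bool; true; false; T)
open import Data.Fin using (Fin; zero; suc; toℕ; inject₁; fromℕ)
open import Data.Fin.Subset using (Subset; _∈_; _∉_; _⊆_; ⊤; _-_; ∣_∣; Nonempty)
open import Data.Product using (Σ; ∃; _×_; _,_)
open import Data.Sum using (_⊎_)
open import Data.List using (List; length)
open import Data.List.Relation.Unary.Unique.Propositional using (Unique)
import Data.List.Membership.Propositional as L
open import Function.Definitions using (Injective)
open import Relation.Binary.PropositionalEquality using (_≡_)
open import Relation.Nullary using (¬_)

record Graph (n : ℕ) : Set where
  field
    adj     : Fin n → Fin n → Bool
    adj-sym : ∀ u v → adj u v ≡ adj v u
    irrefl  : ∀ v → adj v v ≡ false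

module _ {n : ℕ} (G : Graph n) where
  open Graph G

  E : Fin n → Fin n → Set
  E u v = T (adj u v)

  data WalkIn (B : Subset n) : Fin n → Fin n → Set where
    here : ∀ {u} → u ∈ B → WalkIn B u u
    step : ∀ {u v w} → u ∈ B → E u v → WalkIn B v w → WalkIn B u w

  -- The induced subgraph G[B] is connected (empty B counts as connected).
  ConnectedIn : Subset n → Set
  ConnectedIn B = ∀ u v → u ∈ B → v ∈ B → WalkIn B u v

  Connected : Set
  Connected = ConnectedIn ⊤

  NonSeparable : Subset n → Set
  NonSeparable B = Nonempty B × ConnectedIn B × (∀ v → v ∈ B → ConnectedIn (B - v))

  -- A block: a maximal connected subgraph without a cut-vertex
  -- (maximal such subgraphs are induced, so described by their vertex sets).
  IsBlock : Subset n → Set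
  IsBlock B = NonSeparable B × (∀ B′ → B ⊆ B′ → NonSeparable B′ → B′ ≡ B)

  -- A cycle (v_0,…,v_m,v_0) with q = m+1 ≥ 3 distinct vertices
  -- (a closed walk whose only repeated vertex is the start; in a simple graph
  -- this needs at least three vertices).
  record Cycle : Set where
    field
      m      : ℕ
      len≥3  : 2 ≤ m
      vs     : Fin (suc m) → Fin n
      inj    : Injective _≡_ _≡_ vs
      edges  : ∀ (i : Fin m) → E (vs (inject₁ i)) (vs (suc i))
      close  : E (vs (fromℕ m)) (vs zero)

  open Cycle public

  OnCycle : Cycle → Fin n → Set
  OnCycle C v = ∃ λ i → vs C i ≡ v

  Consecutive : (m : ℕ) → Fin (suc m) → Fin (suc m) → Set
  Consecutive m i j =
    toℕ j ≡ suc (toℕ i) ⊎ toℕ i ≡ suc (toℕ j)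
    ⊎ (toℕ i ≡ m × toℕ j ≡ 0) ⊎ (toℕ j ≡ m × toℕ i ≡ 0)

  InducedCycle : Cycle → Set
  InducedCycle C = ∀ i j → E (vs C i) (vs C j) → Consecutive (m C) i j

  Chordal : Set
  Chordal = ∀ (C : Cycle) → InducedCycle C → suc (m C) ≤ 3

  Icc : Subset n → Fin n → Set
  Icc S v = v ∈ S ⊎
    Σ Cycle (λ C → OnCycle C v × v ∉ S × (∀ u → OnCycle C u → u ∉ S → u ≡ v))

  Convex : Subset n → Set
  Convex S = ∀ v → Icc S v → v ∈ S

  IsHull : Subset n → Subset n → Set
  IsHull S H = S ⊆ H × Convex H × (∀ C → S ⊆ C → Convex C → H ⊆ C)

  HullSet : Subset n → Set
  HullSet S = Σ (Subset n) (λ H → IsHull S H × H ≡ ⊤)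

  HullNumber≡ : ℕ → Set
  HullNumber≡ k = (Σ (Subset n) λ S → HullSet S × ∣ S ∣ ≡ k)
                × (∀ S → HullSet S → k ≤ ∣ S ∣)

  BlockList : List (Subset n) → Set
  BlockList bs = Unique bs × (∀ B → IsBlock B → B L.∈ bs) × (∀ B → B L.∈ bs → IsBlock B)

{- Call D triangle-closed if z ∈ D whenever z is adjacent to both ends of an edge inside D.
   Convex sets and blocks are triangle-closed.  In a chordal graph, if vx is an edge inside a
   triangle-closed D, v ~ y, and y can be reached from x avoiding v, then y ∈ D.  Hence a
   triangle-closed set containing an edge of a nonseparable set B contains all of B.

   Lower bound: a step S ↦ S ∪ {v} with v ∈ Icc(S) raises ∣S∣ by one and Σ_B (∣S ∩ B∣ ∸ 2) by at
   least one, so n + Σ_B (∣S ∩ B∣ ∸ 2) ≤ ∣S∣ + Σ_B (∣B∣ ∸ 2) for every hull set S; growing a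
   connected set vertex by vertex gives Σ_B (∣B∣ ∸ 1) < n, and ∣B∣ ≥ 2 for all p blocks.

   Upper bound: starting from a single vertex, repeatedly choose an edge uw leaving H, add w to S
   and the whole block of uw to H; the convex hull of S still contains H, and every step absorbs
   a new block, so at most p vertices are added. -}
module Submission where

open import Defs
open import Data.Nat using (ℕ; zero; suc; _+_; _∸_; _≤_; _<_; z≤n; s≤s)
open import Data.Nat.Properties
open import Data.Nat.ListAction using (sum)
open import Algebra.Properties.CommutativeSemigroup +-commutativeSemigroup using (x∙yz≈y∙xz)
open import Data.Bool using (true; false; if_then_else_; T)
open import Data.Bool.Properties using () renaming (_≟_ to _≟ᵇ_)
open import Data.Fin using (Fin; zero; suc; toℕ; inject₁; fromℕ; fromℕ<)
open import Data.Fin.Properties as Fin using (toℕ-injective; toℕ-inject₁; toℕ-fromℕ; toℕ<n)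
open import Data.Fin.Relation.Unary.Top using (View; view; ‵fromℕ; ‵inject₁)
open import Data.Fin.Subset using (Subset; _∈_; _∉_; _⊆_; _⊂_; _⊃_; ⊤; _-_; ∣_∣; Nonempty; _∪_; _∩_; ⁅_⁆)
open import Data.Fin.Subset.Properties
open import Data.Fin.Subset.Induction using (Acc; acc; ⊃-wellFounded)
open import Data.Product using (∃; ∃₂; _×_; _,_; proj₁; proj₂)
open import Data.Sum using (_⊎_; inj₁; inj₂; [_,_]′)
open import Data.Vec using (_∷_; there)
open import Data.Vec.Properties using (≡-dec)
open import Data.List using (List; []; _∷_; length; map)
open import Data.List.Membership.Propositional using (find; lose) renaming (_∈_ to _∈ˡ_)
open import Data.List.Relation.Unary.Any as Any using (any?)
import Data.List.Relation.Unary.All as All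
open import Data.List.Relation.Unary.AllPairs using (_∷_)
open import Data.List.Relation.Unary.Unique.Propositional using (Unique)
open import Function using (_∘_; id)
open import Relation.Binary.Definitions using (tri<; tri≈; tri>)
open import Relation.Binary.PropositionalEquality
open import Relation.Nullary using (¬_; Dec; does; yes; no; contradiction)
open import Relation.Nullary.Decidable using (decidable-stable; dec-true; dec-false)

-- Subsets of a finite set.

x∈p-y⇒x∈p : ∀ {n} {p : Subset n} {x} y → x ∈ p - y → x ∈ p
x∈p-y⇒x∈p {p = p} y = p─q⊆p p ⁅ y ⁆

x∉p-x : ∀ {n} (p : Subset n) x → x ∉ p - x
x∉p-x (_ ∷ p) zero    ()
x∉p-x (_ ∷ p) (suc x) (there x∈) = x∉p-x p x x∈

x∈p-y⇒x≢y : ∀ {n} {p : Subset n} {x} y → x ∈ p - y → x ≢ y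
x∈p-y⇒x≢y {p = p} y x∈ refl = x∉p-x p y x∈

p-x⊆⊤-x : ∀ {n} {p : Subset n} x → p - x ⊆ ⊤ - x
p-x⊆⊤-x x y∈ = x∈p∧x≢y⇒x∈p-y ∈⊤ (x∈p-y⇒x≢y x y∈)

∣p∪⁅x⁆∣≤1+∣p∣ : ∀ {n} (p : Subset n) x → ∣ p ∪ ⁅ x ⁆ ∣ ≤ suc ∣ p ∣
∣p∪⁅x⁆∣≤1+∣p∣ (true  ∷ p) zero rewrite ∪-identityʳ p = n≤1+n _
∣p∪⁅x⁆∣≤1+∣p∣ (false ∷ p) zero rewrite ∪-identityʳ p = ≤-refl
∣p∪⁅x⁆∣≤1+∣p∣ (true  ∷ p) (suc x) = s≤s (∣p∪⁅x⁆∣≤1+∣p∣ p x)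
∣p∪⁅x⁆∣≤1+∣p∣ (false ∷ p) (suc x) = ∣p∪⁅x⁆∣≤1+∣p∣ p x

x∉p⇒p⊂p∪⁅x⁆ : ∀ {n} {p : Subset n} {x} → x ∉ p → p ⊂ p ∪ ⁅ x ⁆
x∉p⇒p⊂p∪⁅x⁆ {p = p} {x} x∉p = p⊆p∪q ⁅ x ⁆ , x , q⊆p∪q p ⁅ x ⁆ (x∈⁅x⁆ x) , x∉p

∩-monoˡ-⊆ : ∀ {n} {p q : Subset n} r → p ⊆ q → p ∩ r ⊆ q ∩ r
∩-monoˡ-⊆ {p = p} r p⊆q x∈ with x∈p , x∈r ← x∈p∩q⁻ p r x∈ = x∈p∩q⁺ (p⊆q x∈p , x∈r)

x≢y⇒2≤∣p∣ : ∀ {n} {p : Subset n} {x y} → x ∈ p → y ∈ p → x ≢ y → 2 ≤ ∣ p ∣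
x≢y⇒2≤∣p∣ {p = p} {x} {y} x∈p y∈p x≢y = subst (_< ∣ p ∣) (∣⁅x⁆∣≡1 x)
  (p⊂q⇒∣p∣<∣q∣ ((λ z∈ → subst (_∈ p) (sym (x∈⁅y⁆⇒x≡y x z∈)) x∈p) , y , y∈p ,
                 λ y∈ → x≢y (sym (x∈⁅y⁆⇒x≡y x y∈))))

_≡?_ : ∀ {n} (p q : Subset n) → Dec (p ≡ q)
_≡?_ = ≡-dec _≟ᵇ_

-- Strict inclusion cannot ascend forever in a finite set. Both bounds run on this induction, with
-- `Spread` and `CheaplySpanned` as the invariant `P`.
⊂-grow : ∀ {n} (P : Subset n → Set) → (∀ {p} → P p → p ≢ ⊤ → ∃ λ q → p ⊂ q × P q) →
         ∀ {p} → P p → P ⊤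
⊂-grow P grow = go (⊃-wellFounded _)
  where
  go : ∀ {p} → Acc _⊃_ p → P p → P ⊤
  go {p} (acc larger) Pp with p ≡? ⊤
  ... | yes refl = Pp
  ... | no  p≢⊤ with q , p⊂q , Pq ← grow Pp p≢⊤ = go (larger p⊂q) Pq

-- Sums over lists.

module _ {A : Set} {f g : A → ℕ} where

  sum-mono-≤ : ∀ xs → (∀ {x} → x ∈ˡ xs → f x ≤ g x) → sum (map f xs) ≤ sum (map g xs)
  sum-mono-≤ []       f≤g = z≤n
  sum-mono-≤ (x ∷ xs) f≤g = +-mono-≤ (f≤g (Any.here refl)) (sum-mono-≤ xs (f≤g ∘ Any.there))

  sum-mono-< : ∀ {x} {xs} → (∀ {x} → x ∈ˡ xs → f x ≤ g x) → x ∈ˡ xs → f x < g x →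
               sum (map f xs) < sum (map g xs)
  sum-mono-< {xs = _ ∷ xs} f≤g (Any.here refl) fx<gx = +-mono-<-≤ fx<gx (sum-mono-≤ xs (f≤g ∘ Any.there))
  sum-mono-< f≤g (Any.there x∈) fx<gx = +-mono-≤-< (f≤g (Any.here refl)) (sum-mono-< (f≤g ∘ Any.there) x∈ fx<gx)

  length+sum-mono-≤ : ∀ xs → (∀ {x} → x ∈ˡ xs → f x < g x) → length xs + sum (map f xs) ≤ sum (map g xs)
  length+sum-mono-≤ []       f<g = z≤n
  length+sum-mono-≤ (x ∷ xs) f<g = begin
    suc (length xs + (f x + sum (map f xs)))  ≡⟨ cong suc (x∙yz≈y∙xz (length xs) (f x) _) ⟩
    suc (f x) + (length xs + sum (map f xs))  ≤⟨ +-mono-≤ (f<g (Any.here refl)) (length+sum-mono-≤ xs (f<g ∘ Any.there)) ⟩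
    g x + sum (map g xs)                      ∎
    where open ≤-Reasoning

  -- The last hypothesis only identifies entries with `g x < f x` as elements; `Unique` turns this
  -- into a single position of the list, so at most one term grows.
  sum≤1+sum : ∀ {xs} → Unique xs → (∀ {x} → x ∈ˡ xs → f x ≤ suc (g x)) →
              (∀ {x y} → x ∈ˡ xs → y ∈ˡ xs → g x < f x → g y < f y → x ≡ y) →
              sum (map f xs) ≤ suc (sum (map g xs))
  sum≤1+sum {[]}     _            _     _      = z≤n
  sum≤1+sum {x ∷ xs} (x∉ ∷ uniq) f≤1+g single with f x ≤? g x
  ... | yes fx≤gx = ≤-trans
    (+-mono-≤ fx≤gx (sum≤1+sum uniq (f≤1+g ∘ Any.there) λ y∈ z∈ → single (Any.there y∈) (Any.there z∈)))
    (≤-reflexive (+-suc (g x) _))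
  ... | no fx≰gx = +-mono-≤ (f≤1+g (Any.here refl)) (sum-mono-≤ xs λ y∈ → ≮⇒≥ λ gy<fy →
    All.lookup x∉ y∈ (single (Any.here refl) (Any.there y∈) (≰⇒> fx≰gx) gy<fy))

module _ {n : ℕ} (G : Graph n) where
  open Graph G

  private
    _~_ : Fin n → Fin n → Set
    _~_ = E G

    Walk : Subset n → Fin n → Fin n → Set
    Walk = WalkIn G

  ~-sym : ∀ {u v} → u ~ v → v ~ u
  ~-sym {u} {v} = subst T (adj-sym u v)

  ~-irrefl : ∀ {v} → ¬ v ~ v
  ~-irrefl {v} = subst T (irrefl v)

  ~⇒≢ : ∀ {u v} → u ~ v → u ≢ v
  ~⇒≢ u~u refl = ~-irrefl u~u

  -- Walks, their positions and their pieces.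

  walk-start : ∀ {B u v} → Walk B u v → u ∈ B
  walk-start (here u∈B)     = u∈B
  walk-start (step u∈B _ _) = u∈B

  walk-mono : ∀ {A B u v} → A ⊆ B → Walk A u v → Walk B u v
  walk-mono A⊆B (here u∈A)       = here (A⊆B u∈A)
  walk-mono A⊆B (step u∈A u~v w) = step (A⊆B u∈A) u~v (walk-mono A⊆B w)

  _++_ : ∀ {B u v x} → Walk B u v → Walk B v x → Walk B u x
  here _         ++ w′ = w′
  step u∈B u~v w ++ w′ = step u∈B u~v (w ++ w′)

  walk-sym : ∀ {B u v} → Walk B u v → Walk B v u
  walk-sym (here u∈B)       = here u∈B
  walk-sym (step u∈B u~v w) = walk-sym w ++ step (walk-start w) (~-sym u~v) (here u∈B)

  len : ∀ {B u v} → Walk B u v → ℕ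
  len (here _)     = 0
  len (step _ _ w) = suc (len w)

  len-++ : ∀ {B u v x} (w : Walk B u v) (w′ : Walk B v x) → len (w ++ w′) ≡ len w + len w′
  len-++ (here _)     w′ = refl
  len-++ (step _ _ w) w′ = cong suc (len-++ w w′)

  at : ∀ {B u v} (w : Walk B u v) → Fin (suc (len w)) → Fin n
  at {u = u} w    zero    = u
  at (step _ _ w) (suc i) = at w i

  at∈ : ∀ {B u v} (w : Walk B u v) i → at w i ∈ B
  at∈ w            zero    = walk-start w
  at∈ (step _ _ w) (suc i) = at∈ w i

  at-last : ∀ {B u v} (w : Walk B u v) → at w (fromℕ (len w)) ≡ v
  at-last (here _)     = refl
  at-last (step _ _ w) = at-last w

  at-step : ∀ {B u v} (w : Walk B u v) (i : Fin (len w)) → at w (inject₁ i) ~ at w (suc i)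
  at-step (step _ u~v w) zero    = u~v
  at-step (step _ _   w) (suc i) = at-step w i

  prefix : ∀ {B u v} (w : Walk B u v) i → Walk B u (at w i)
  prefix w                zero    = here (walk-start w)
  prefix (step u∈B u~v w) (suc i) = step u∈B u~v (prefix w i)

  suffix : ∀ {B u v} (w : Walk B u v) i → Walk B (at w i) v
  suffix w            zero    = w
  suffix (step _ _ w) (suc i) = suffix w i

  len-prefix : ∀ {B u v} (w : Walk B u v) i → len (prefix w i) ≡ toℕ i
  len-prefix w            zero    = refl
  len-prefix (step _ _ w) (suc i) = cong suc (len-prefix w i)

  len-suffix : ∀ {B u v} (w : Walk B u v) i → toℕ i + len (suffix w i) ≡ len w
  len-suffix w            zero    = refl
  len-suffix (step _ _ w) (suc i) = cong suc (len-suffix w i)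

  -- Here `k` is the length of whatever replaces the first `toℕ j` steps of `w`.
  len-shortcut : ∀ {B u v} (w : Walk B u v) j {k} → k < toℕ j →
                 k + len (suffix w j) < len w
  len-shortcut w j {k} k<j =
    subst (k + len (suffix w j) <_) (len-suffix w j) (+-monoˡ-< (len (suffix w j)) k<j)

  -- Triangle-closed sets in chordal graphs.

  TriangleClosed : Subset n → Set
  TriangleClosed D = ∀ {u v z} → u ∈ D → v ∈ D → u ~ v → u ~ z → v ~ z → z ∈ D

  module _ (chordal : Chordal G) {D : Subset n} (closed : TriangleClosed D) where

    -- If y ∉ D, then a shortest such walk together with v is an induced cycle, hence a triangle.
    private
      link-closed′ : ∀ k {v x y} → v ∈ D → x ∈ D → v ~ x → v ~ y →
                     (w : Walk (⊤ - v) x y) → len w < k → y ∈ D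
      link-closed′ (suc k) {v} {x} {y} v∈D x∈D v~x v~y w (s≤s len≤k) =
        decidable-stable (y ∈? D) contra
        where
        -- The induction hypothesis: `v` stays fixed, while both ends of the walk may change.
        -- `no-spoke` uses both freedoms.
        shorter : ∀ {x′ y′} → x′ ∈ D → v ~ x′ → v ~ y′ → (w′ : Walk (⊤ - v) x′ y′) →
                  len w′ < len w → y′ ∈ D
        shorter x′∈D v~x′ v~y′ w′ w′<w = link-closed′ k v∈D x′∈D v~x′ v~y′ w′ (<-≤-trans w′<w len≤k)

        module _ (y∉D : y ∉ D) where

          -- Skipping the stretch between two equal positions would shorten the walk from `x` to
          -- `y`, and `shorter` would put `y` in `D`.
          no-repeat : ∀ {i j} → toℕ i < toℕ j → at w i ≢ at w j
          no-repeat {i} {j} i<j eq = y∉D (shorter x∈D v~x v~y w′ w′<w)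
            where
            p  = subst (Walk _ x) eq (prefix w i)
            len-subst : ∀ {a b} (e : a ≡ b) (q : Walk (⊤ - v) x a) →
                        len (subst (Walk _ x) e q) ≡ len q
            len-subst refl _ = refl
            w′ = p ++ suffix w j
            w′<w : len w′ < len w
            w′<w rewrite len-++ p (suffix w j) | len-subst eq (prefix w i) | len-prefix w i =
              len-shortcut w j i<j

          no-chord : ∀ {i j} → suc (toℕ i) < toℕ j → ¬ at w i ~ at w j
          no-chord {i} {j} i+1<j i~j = y∉D (shorter x∈D v~x v~y w′ w′<w)
            where
            q  = step (at∈ w i) i~j (suffix w j)
            w′ = prefix w i ++ q
            w′<w : len w′ < len w
            w′<w rewrite len-++ (prefix w i) q | len-prefix w i | +-suc (toℕ i) (len (suffix w j)) =
              len-shortcut w j i+1<j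

          -- A neighbour of `v` strictly inside the walk is the end of a proper prefix, so the
          -- induction hypothesis puts it in `D`. It can then replace `x` as the start, and the
          -- remaining suffix, shorter again, gives `y ∈ D`.
          no-spoke : ∀ {i} → 0 < toℕ i → toℕ i < len w → ¬ v ~ at w i
          no-spoke {i} 0<i i<len v~i =
            y∉D (shorter at∈D v~i v~y (suffix w i) (len-shortcut w i 0<i))
            where
            at∈D = shorter x∈D v~x v~i (prefix w i)
                     (subst (_< len w) (sym (len-prefix w i)) i<len)

          verts : Fin (suc (suc (len w))) → Fin n
          verts zero    = v
          verts (suc i) = at w i

          verts-inj : ∀ {i j} → verts i ≡ verts j → i ≡ j
          verts-inj {zero}  {zero}  _  = refl
          verts-inj {zero}  {suc j} eq = contradiction (sym eq) (x∈p-y⇒x≢y v (at∈ w j))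
          verts-inj {suc i} {zero}  eq = contradiction eq (x∈p-y⇒x≢y v (at∈ w i))
          verts-inj {suc i} {suc j} eq with <-cmp (toℕ i) (toℕ j)
          ... | tri< i<j _ _ = contradiction eq (no-repeat i<j)
          ... | tri≈ _ i≡j _ = cong suc (toℕ-injective i≡j)
          ... | tri> _ _ j<i = contradiction (sym eq) (no-repeat j<i)

          cyc : 2 ≤ suc (len w) → Cycle G
          cyc 2≤ = record
            { m = suc (len w) ; len≥3 = 2≤ ; vs = verts ; inj = verts-inj
            ; edges = λ { zero → v~x ; (suc i) → at-step w i }
            ; close = ~-sym (subst (v ~_) (sym (at-last w)) v~y) }

          spokes : ∀ i → v ~ at w i → Consecutive G (suc (len w)) zero (suc i)
          spokes zero    _   = inj₁ refl
          spokes (suc i) v~i with m≤n⇒m<n∨m≡n (≤-pred (toℕ<n (suc i)))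
          ... | inj₁ i<len = contradiction v~i (no-spoke {suc i} (s≤s z≤n) i<len)
          -- The last position holds `y`, joined to `v` by the closing edge.
          ... | inj₂ i≡len = inj₂ (inj₂ (inj₂ (cong suc i≡len , refl)))

          consecutive-sym : ∀ {m i j} → Consecutive G m i j → Consecutive G m j i
          consecutive-sym (inj₁ e)               = inj₂ (inj₁ e)
          consecutive-sym (inj₂ (inj₁ e))        = inj₁ e
          consecutive-sym (inj₂ (inj₂ (inj₁ e))) = inj₂ (inj₂ (inj₂ e))
          consecutive-sym (inj₂ (inj₂ (inj₂ e))) = inj₂ (inj₂ (inj₁ e))

          rims : ∀ i j → toℕ i < toℕ j → at w i ~ at w j →
                 Consecutive G (suc (len w)) (suc i) (suc j)
          rims i j i<j i~j with m≤n⇒m<n∨m≡n i<j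
          ... | inj₁ i+1<j = contradiction i~j (no-chord i+1<j)
          ... | inj₂ i+1≡j = inj₁ (cong suc (sym i+1≡j))

          induced : ∀ 2≤ → InducedCycle G (cyc 2≤)
          induced _ zero    zero    e = contradiction e ~-irrefl
          induced _ zero    (suc j) e = spokes j e
          induced _ (suc i) zero    e = consecutive-sym {i = zero} {j = suc i} (spokes i (~-sym e))
          induced _ (suc i) (suc j) e with <-cmp (toℕ i) (toℕ j)
          ... | tri< i<j _ _ = rims i j i<j e
          ... | tri≈ _ i≡j _ = contradiction (cong (at w) (toℕ-injective i≡j)) (~⇒≢ e)
          ... | tri> _ _ j<i = consecutive-sym {i = suc j} {j = suc i} (rims j i j<i (~-sym e))

          -- The cycle has `len w + 2` vertices and chordality allows three. Length 0 is split off
          -- because it yields no cycle.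
          short : len w ≤ 1
          short with len w ≤? 0
          ... | yes len≤0 = ≤-trans len≤0 z≤n
          ... | no  len≰0 = ≤-pred (≤-pred (chordal (cyc 2≤) (induced 2≤)))
            where 2≤ = s≤s (≰⇒> len≰0)

        contra : ¬ (y ∉ D)
        contra y∉D = y∉D (short-closed w (short y∉D))
          where
          short-closed : (w : Walk (⊤ - v) x y) → len w ≤ 1 → y ∈ D
          short-closed (here _)              _ = x∈D
          short-closed (step _ x~y (here _)) _ = closed v∈D x∈D v~x v~y x~y
          short-closed (step _ _ (step _ _ _)) (s≤s ())

    link-closed : ∀ {v x y} → v ∈ D → x ∈ D → v ~ x → v ~ y → Walk (⊤ - v) x y → y ∈ D
    link-closed v∈D x∈D v~x v~y w = link-closed′ (suc (len w)) v∈D x∈D v~x v~y w ≤-refl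

    -- An edge inside `D` is pushed along a walk in `B` towards `x`. When the walk leaves `u` for
    -- `y`, connectedness of `B - u` joins `v` to `y` avoiding `u`, so `link-closed` at `u` gives
    -- `y ∈ D`, and the edge from `y` to `u` takes over.
    nonSeparable⊆ : ∀ {B u v} → NonSeparable G B → u ∈ B → v ∈ B → u ∈ D → v ∈ D → u ~ v → B ⊆ D
    nonSeparable⊆ {B} {u} (_ , conn , conn-) u∈B v∈B u∈D v∈D u~v {x} x∈B =
      go v∈B u∈D v∈D u~v (conn u x u∈B x∈B)
      where
      go : ∀ {u v} → v ∈ B → u ∈ D → v ∈ D → u ~ v → Walk B u x → x ∈ D
      go _ u∈D _ _ (here _) = u∈D
      go {u} {v} v∈B u∈D v∈D u~v (step {v = y} u∈B u~y w) =
        go u∈B y∈D u∈D (~-sym u~y) w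
        where
        v⇝y = conn- u u∈B v y (x∈p∧x≢y⇒x∈p-y v∈B (≢-sym (~⇒≢ u~v)))
                               (x∈p∧x≢y⇒x∈p-y (walk-start w) (≢-sym (~⇒≢ u~y)))
        y∈D = link-closed u∈D v∈D u~v u~y (walk-mono (p-x⊆⊤-x u) v⇝y)

  -- A triangle is itself a cycle, and `z` would be its only vertex outside `S`.
  convex⇒triangleClosed : ∀ {S} → Convex G S → TriangleClosed S
  convex⇒triangleClosed {S} convex {u} {v} {z} u∈S v∈S u~v u~z v~z with z ∈? S
  ... | yes z∈S = z∈S
  ... | no  z∉S = convex z (inj₂ (triangle , (zero , refl) , z∉S , only))
    where
    verts : Fin 3 → Fin n
    verts zero             = z
    verts (suc zero)       = u
    verts (suc (suc zero)) = v
    verts-inj : ∀ {i j} → verts i ≡ verts j → i ≡ j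
    verts-inj {zero}           {zero}           _  = refl
    verts-inj {zero}           {suc zero}       eq = contradiction (sym eq) (~⇒≢ u~z)
    verts-inj {zero}           {suc (suc zero)} eq = contradiction (sym eq) (~⇒≢ v~z)
    verts-inj {suc zero}       {zero}           eq = contradiction eq (~⇒≢ u~z)
    verts-inj {suc zero}       {suc zero}       _  = refl
    verts-inj {suc zero}       {suc (suc zero)} eq = contradiction eq (~⇒≢ u~v)
    verts-inj {suc (suc zero)} {zero}           eq = contradiction eq (~⇒≢ v~z)
    verts-inj {suc (suc zero)} {suc zero}       eq = contradiction (sym eq) (~⇒≢ u~v)
    verts-inj {suc (suc zero)} {suc (suc zero)} _  = refl
    triangle : Cycle G
    triangle = record
      { m = 2 ; len≥3 = ≤-refl ; vs = verts ; inj = verts-inj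
      ; edges = λ { zero → ~-sym u~z ; (suc zero) → u~v } ; close = v~z }
    only : ∀ w → OnCycle G triangle w → w ∉ S → w ≡ z
    only _ (zero           , refl) _   = refl
    only _ (suc zero       , refl) u∉S = contradiction u∈S u∉S
    only _ (suc (suc zero) , refl) v∉S = contradiction v∈S v∉S

  -- Arcs of a cycle.

  walk-down : ∀ {B m} (f : Fin (suc m) → Fin n) → (∀ i → f (inject₁ i) ~ f (suc i)) →
              (j : Fin m) → (∀ k → toℕ k ≤ toℕ j → f k ∈ B) → Walk B (f zero) (f (inject₁ j))
  walk-down f f~ zero    f∈ = here (f∈ zero z≤n)
  walk-down f f~ (suc j) f∈ =
    step (f∈ zero z≤n) (f~ zero) (walk-down (f ∘ suc) (f~ ∘ suc) j (λ k → f∈ (suc k) ∘ s≤s))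

  walk-all : ∀ {B m} (f : Fin (suc m) → Fin n) → (∀ i → f (inject₁ i) ~ f (suc i)) →
             (∀ k → f k ∈ B) → Walk B (f zero) (f (fromℕ m))
  walk-all {m = zero}  f f~ f∈ = here (f∈ zero)
  walk-all {m = suc m} f f~ f∈ = step (f∈ zero) (f~ zero) (walk-all (f ∘ suc) (f~ ∘ suc) (f∈ ∘ suc))

  walk-up : ∀ {B m} (f : Fin (suc m) → Fin n) → (∀ i → f (inject₁ i) ~ f (suc i)) →
            (j : Fin m) → (∀ k → toℕ j < toℕ k → f k ∈ B) → Walk B (f (suc j)) (f (fromℕ m))
  walk-up f f~ zero    f∈ = walk-all (f ∘ suc) (f~ ∘ suc) (λ k → f∈ (suc k) (s≤s z≤n))
  walk-up f f~ (suc j) f∈ = walk-up (f ∘ suc) (f~ ∘ suc) j (λ k → f∈ (suc k) ∘ s≤s)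

  -- The view of a cycle from one vertex `v`: its two cycle neighbours, and the rest of the cycle as
  -- a walk between them avoiding `v`.
  record CycleNeighbours (C : Cycle G) (v : Fin n) : Set where
    field
      x y : Fin n
      x∈C : OnCycle G C x
      y∈C : OnCycle G C y
      x≢y : x ≢ y
      v~x : v ~ x
      v~y : v ~ y
      x⇝y : Walk (⊤ - v) x y

  cycleNeighbours : ∀ (C : Cycle G) {v} → OnCycle G C v → CycleNeighbours C v
  cycleNeighbours record { m = suc zero ; len≥3 = s≤s () } (zero , refl)
  cycleNeighbours record { m = suc (suc m) ; vs = f ; inj = inj ; edges = f~ ; close = close }
                  (zero , refl) = record
    { x = f (suc zero) ; y = f (fromℕ (suc (suc m)))
    ; x∈C = _ , refl ; y∈C = _ , refl
    ; x≢y = λ eq → contradiction (inj eq) λ ()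
    ; v~x = f~ zero ; v~y = ~-sym close
    ; x⇝y = walk-all (f ∘ suc) (f~ ∘ suc) (λ k →
        x∈p∧x≢y⇒x∈p-y ∈⊤ λ eq → contradiction (inj eq) λ ()) }
  cycleNeighbours C@record { m = m ; len≥3 = len≥3 ; vs = f ; inj = inj ; edges = f~ ; close = close }
                  (suc j , refl) = go (view (suc j)) refl
    where
    off : ∀ {k} → toℕ k ≢ toℕ (suc j) → f k ∈ ⊤ - f (suc j)
    off k≢ = x∈p∧x≢y⇒x∈p-y ∈⊤ λ eq → k≢ (cong toℕ (inj eq))
    down = walk-down f f~ j λ k k≤j → off (<⇒≢ (s≤s k≤j))
    go : ∀ {i} → View i → i ≡ suc j → CycleNeighbours C (f (suc j))
    go ‵fromℕ eq = record
      { x = f zero ; y = f (inject₁ j) ; x∈C = _ , refl ; y∈C = _ , refl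
      -- `v` is in last position, so its neighbours sit at 0 and `j`; `len≥3` makes `j` positive.
      ; x≢y = λ e → contradiction (trans (cong toℕ (inj e)) (toℕ-inject₁ j))
                (<⇒≢ (≤-pred (subst (2 ≤_) (trans (sym (toℕ-fromℕ m)) (cong toℕ eq)) len≥3)))
      ; v~x = subst (λ i → f i ~ f zero) eq close ; v~y = ~-sym (f~ j) ; x⇝y = down }
    go (‵inject₁ i) eq = record
      { x = f (inject₁ j) ; y = f (suc i) ; x∈C = _ , refl ; y∈C = _ , refl
      ; x≢y = λ e → <⇒≢ (s≤s (≤-trans (n≤1+n _) (≤-reflexive (sym i≡))))
                       (trans (sym (toℕ-inject₁ j)) (cong toℕ (inj e)))
      ; v~x = ~-sym (f~ j) ; v~y = subst (λ k → f k ~ f (suc i)) eq (f~ i)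
      -- The long way round: from position `j` down to 0, across the closing edge to the last
      -- position, then down to the one after `v`.
      ; x⇝y = walk-sym down ++ step (walk-start down) (~-sym close)
               (walk-sym (walk-up f f~ i λ k i<k → off (>⇒≢ (subst (_< toℕ k) i≡ i<k)))) }
      where
      i≡ : toℕ i ≡ suc (toℕ j)
      i≡ = trans (sym (toℕ-inject₁ i)) (cong toℕ eq)

  -- Enlarging connected and nonseparable sets.

  connected-resp : ∀ {A B} → A ⊆ B → B ⊆ A → ConnectedIn G A → ConnectedIn G B
  connected-resp A⊆B B⊆A conn u v u∈B v∈B = walk-mono A⊆B (conn u v (B⊆A u∈B) (B⊆A v∈B))

  connected-singleton : ∀ {A c} → (∀ {x} → x ∈ A → x ≡ c) → ConnectedIn G A
  connected-singleton {A} A⊆c u v u∈A v∈A =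
    subst (Walk A u) (trans (A⊆c u∈A) (sym (A⊆c v∈A))) (here u∈A)

  connected-∪⁅⁆ : ∀ {A u z} → ConnectedIn G A → u ∈ A → u ~ z → ConnectedIn G (A ∪ ⁅ z ⁆)
  connected-∪⁅⁆ {A} {u} {z} conn u∈A u~z a b a∈ b∈ = toHub a∈ ++ walk-sym (toHub b∈)
    where
    toHub : ∀ {x} → x ∈ A ∪ ⁅ z ⁆ → Walk (A ∪ ⁅ z ⁆) x u
    toHub {x} x∈ with x∈p∪q⁻ A ⁅ z ⁆ x∈
    ... | inj₁ x∈A = walk-mono (p⊆p∪q ⁅ z ⁆) (conn x u x∈A u∈A)
    ... | inj₂ x∈z with refl ← x∈⁅y⁆⇒x≡y z x∈z =
      step x∈ (~-sym u~z) (here (p⊆p∪q ⁅ z ⁆ u∈A))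

  nonSeparable-edge : ∀ {u v} → u ~ v → NonSeparable G (⁅ u ⁆ ∪ ⁅ v ⁆)
  nonSeparable-edge {u} {v} u~v =
    (u , p⊆p∪q ⁅ v ⁆ (x∈⁅x⁆ u)) ,
    connected-∪⁅⁆ (connected-singleton (x∈⁅y⁆⇒x≡y u)) (x∈⁅x⁆ u) u~v ,
    λ x x∈ → minus (x∈p∪q⁻ ⁅ u ⁆ ⁅ v ⁆ x∈)
    where
    minus : ∀ {x} → x ∈ ⁅ u ⁆ ⊎ x ∈ ⁅ v ⁆ → ConnectedIn G ((⁅ u ⁆ ∪ ⁅ v ⁆) - x)
    minus (inj₁ x∈u) with refl ← x∈⁅y⁆⇒x≡y u x∈u = connected-singleton λ {y} y∈ →
      [ (λ y∈u → contradiction (x∈⁅y⁆⇒x≡y u y∈u) (x∈p-y⇒x≢y u y∈)) , x∈⁅y⁆⇒x≡y v ]′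
      (x∈p∪q⁻ ⁅ u ⁆ ⁅ v ⁆ (x∈p-y⇒x∈p u y∈))
    minus (inj₂ x∈v) with refl ← x∈⁅y⁆⇒x≡y v x∈v = connected-singleton λ {y} y∈ →
      [ x∈⁅y⁆⇒x≡y u , (λ y∈v → contradiction (x∈⁅y⁆⇒x≡y v y∈v) (x∈p-y⇒x≢y v y∈)) ]′
      (x∈p∪q⁻ ⁅ u ⁆ ⁅ v ⁆ (x∈p-y⇒x∈p v y∈))

  -- Deleting a vertex of `A` leaves at least one of the two neighbours `u`, `v` to attach `z`;
  -- deleting `z` gives `A` back.
  nonSeparable-∪⁅⁆ : ∀ {A u v z} → NonSeparable G A → u ∈ A → v ∈ A → z ∉ A →
                     u ≢ v → u ~ z → v ~ z → NonSeparable G (A ∪ ⁅ z ⁆)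
  nonSeparable-∪⁅⁆ {A} {u} {v} {z} (_ , conn , conn-) u∈A v∈A z∉A u≢v u~z v~z =
    (u , p⊆p∪q ⁅ z ⁆ u∈A) , connected-∪⁅⁆ conn u∈A u~z , λ x x∈ → minus (x∈p∪q⁻ A ⁅ z ⁆ x∈)
    where
    minus : ∀ {x} → x ∈ A ⊎ x ∈ ⁅ z ⁆ → ConnectedIn G ((A ∪ ⁅ z ⁆) - x)
    minus {x} (inj₁ x∈A) = connected-resp to from hubbed
      where
      x≢z : x ≢ z
      x≢z refl = z∉A x∈A
      hubbed : ConnectedIn G ((A - x) ∪ ⁅ z ⁆)
      hubbed with u Fin.≟ x
      ... | no  u≢x  = connected-∪⁅⁆ (conn- x x∈A) (x∈p∧x≢y⇒x∈p-y u∈A u≢x) u~z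
      ... | yes refl = connected-∪⁅⁆ (conn- x x∈A) (x∈p∧x≢y⇒x∈p-y v∈A (≢-sym u≢v)) v~z
      to : (A - x) ∪ ⁅ z ⁆ ⊆ (A ∪ ⁅ z ⁆) - x
      to y∈ with x∈p∪q⁻ (A - x) ⁅ z ⁆ y∈
      ... | inj₁ y∈A-x = x∈p∧x≢y⇒x∈p-y (p⊆p∪q ⁅ z ⁆ (x∈p-y⇒x∈p x y∈A-x)) (x∈p-y⇒x≢y x y∈A-x)
      ... | inj₂ y∈z   with refl ← x∈⁅y⁆⇒x≡y z y∈z = x∈p∧x≢y⇒x∈p-y (q⊆p∪q A ⁅ z ⁆ y∈z) (≢-sym x≢z)
      from : (A ∪ ⁅ z ⁆) - x ⊆ (A - x) ∪ ⁅ z ⁆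
      from y∈ with x∈p∪q⁻ A ⁅ z ⁆ (x∈p-y⇒x∈p x y∈)
      ... | inj₁ y∈A = p⊆p∪q ⁅ z ⁆ (x∈p∧x≢y⇒x∈p-y y∈A (x∈p-y⇒x≢y x y∈))
      ... | inj₂ y∈z = q⊆p∪q (A - x) ⁅ z ⁆ y∈z
    minus (inj₂ x∈z) with refl ← x∈⁅y⁆⇒x≡y z x∈z = connected-resp to from conn
      where
      to : A ⊆ (A ∪ ⁅ z ⁆) - z
      to y∈A = x∈p∧x≢y⇒x∈p-y (p⊆p∪q ⁅ z ⁆ y∈A) λ { refl → z∉A y∈A }
      from : (A ∪ ⁅ z ⁆) - z ⊆ A
      from y∈ = [ id , (λ y∈z → contradiction (x∈⁅y⁆⇒x≡y z y∈z) (x∈p-y⇒x≢y z y∈)) ]′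
                (x∈p∪q⁻ A ⁅ z ⁆ (x∈p-y⇒x∈p z y∈))

  -- A vertex `z` outside would give the larger nonseparable set `B ∪ ⁅ z ⁆`, against maximality.
  block-triangleClosed : ∀ {B} → IsBlock G B → TriangleClosed B
  block-triangleClosed {B} (ns , maximal) {u} {v} {z} u∈B v∈B u~v u~z v~z with z ∈? B
  ... | yes z∈B = z∈B
  ... | no  z∉B = subst (z ∈_) (maximal _ (p⊆p∪q ⁅ z ⁆)
                    (nonSeparable-∪⁅⁆ ns u∈B v∈B z∉B (~⇒≢ u~v) u~z v~z))
                  (q⊆p∪q B ⁅ z ⁆ (x∈⁅x⁆ z))

  -- Edges leaving a set, and hull sets.

  frontier : Connected G → ∀ {H c} → c ∈ H → H ≢ ⊤ → ∃₂ λ u v → u ∈ H × v ∉ H × u ~ v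
  frontier conn {H} {c} c∈H H≢⊤ = crossing c∈H (conn c x ∈⊤ ∈⊤)
    where
    outside = Fin.¬∀⟶∃¬ n (_∈ H) (_∈? H) λ all → H≢⊤ (⊆-antisym ⊆⊤ (λ {x} _ → all x))
    x   = proj₁ outside
    x∉H = proj₂ outside
    crossing : ∀ {a} → a ∈ H → Walk ⊤ a x → ∃₂ λ u v → u ∈ H × v ∉ H × u ~ v
    crossing a∈H (here _) = contradiction a∈H x∉H
    crossing {a} a∈H (step {v = b} _ a~b w) with b ∈? H
    ... | yes b∈H = crossing b∈H w
    ... | no  b∉H = a , b , a∈H , b∉H , a~b

  -- Equivalent to `HullSet`, but phrased through convex supersets, so that no hull has to be
  -- constructed.
  Generates : Subset n → Set
  Generates S = ∀ C → S ⊆ C → Convex G C → C ≡ ⊤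

  hullSet⇒generates : ∀ {S} → HullSet G S → Generates S
  hullSet⇒generates (_ , (_ , _ , least) , refl) C S⊆C convex = ⊆-antisym ⊆⊤ (least C S⊆C convex)

  generates⇒hullSet : ∀ {S} → Generates S → HullSet G S
  generates⇒hullSet gen =
    ⊤ , (⊆⊤ , (λ _ _ → ∈⊤) , (λ C S⊆C convex → ⊆-reflexive (sym (gen C S⊆C convex)))) , refl

  -- Blocks of a connected graph.

  module _ (2≤n : 2 ≤ n) (connected : Connected G) (chordal : Chordal G)
           (blocks : List (Subset n)) (blockList : BlockList G blocks) where

    private
      root : Fin n
      root = fromℕ< (≤-trans (s≤s z≤n) 2≤n)

      block : ∀ {B} → B ∈ˡ blocks → IsBlock G B
      block = proj₂ (proj₂ blockList) _

    -- Searching the given list avoids deciding nonseparability. If no listed block contains `A`, a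
    -- strictly larger nonseparable set would by induction lie in one, and so would `A`. Hence `A`
    -- is maximal, a block, and listed after all.
    nonSeparable⊆block : ∀ {A} → NonSeparable G A → ∃ λ B → B ∈ˡ blocks × A ⊆ B
    nonSeparable⊆block = go (⊃-wellFounded _)
      where
      go : ∀ {A} → Acc _⊃_ A → NonSeparable G A → ∃ λ B → B ∈ˡ blocks × A ⊆ B
      go {A} (acc larger) ns with any? (A ⊆?_) blocks
      ... | yes found = find found
      ... | no  none  = contradiction (lose {P = A ⊆_} (proj₁ (proj₂ blockList) A (ns , maximal)) id) none
        where
        maximal : ∀ A′ → A ⊆ A′ → NonSeparable G A′ → A′ ≡ A
        maximal A′ A⊆A′ ns′ = ⊆-antisym A′⊆A A⊆A′
          where
          A′⊆A : A′ ⊆ A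
          A′⊆A {x} x∈A′ = decidable-stable (x ∈? A) λ x∉A →
            let B , B∈ , A′⊆B = go (larger (A⊆A′ , x , x∈A′ , x∉A)) ns′
            in none (lose {P = A ⊆_} B∈ (⊆-trans A⊆A′ A′⊆B))

    edge⊆block : ∀ {u v} → u ~ v → ∃ λ B → B ∈ˡ blocks × u ∈ B × v ∈ B
    edge⊆block {u} {v} u~v with B , B∈ , uv⊆B ← nonSeparable⊆block (nonSeparable-edge u~v) =
      B , B∈ , uv⊆B (p⊆p∪q ⁅ v ⁆ (x∈⁅x⁆ u)) , uv⊆B (q⊆p∪q ⁅ u ⁆ ⁅ v ⁆ (x∈⁅x⁆ v))

    hasNeighbour : ∀ u → ∃ λ v → u ~ v
    hasNeighbour u =
      let a , v , a∈u , _ , a~v = frontier connected (x∈⁅x⁆ u) ⁅u⁆≢⊤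
      in v , subst (_~ v) (x∈⁅y⁆⇒x≡y u a∈u) a~v
      where
      ⁅u⁆≢⊤ : ⁅ u ⁆ ≢ ⊤
      ⁅u⁆≢⊤ eq = <⇒≢ 2≤n (trans (sym (∣⁅x⁆∣≡1 u)) (trans (cong ∣_∣ eq) (∣⊤∣≡n n)))

    -- A one-vertex block would extend to an edge at that vertex.
    2≤∣block∣ : ∀ {B} → B ∈ˡ blocks → 2 ≤ ∣ B ∣
    2≤∣block∣ {B} B∈ = decidable-stable (2 ≤? ∣ B ∣) λ ∣B∣<2 →
      let ((b , b∈B) , _) , maximal = block B∈
          c , b~c = hasNeighbour b
          B⊆bc : B ⊆ ⁅ b ⁆ ∪ ⁅ c ⁆
          B⊆bc {x} x∈B = p⊆p∪q ⁅ c ⁆ (decidable-stable (x ∈? ⁅ b ⁆) λ x∉b →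
            ∣B∣<2 (x≢y⇒2≤∣p∣ x∈B b∈B (x∉⁅y⁆⇒x≢y x∉b)))
          c∈B = subst (c ∈_) (maximal _ B⊆bc (nonSeparable-edge b~c)) (q⊆p∪q ⁅ b ⁆ ⁅ c ⁆ (x∈⁅x⁆ c))
      in ∣B∣<2 (x≢y⇒2≤∣p∣ b∈B c∈B (~⇒≢ b~c))

    -- Lower bound: counting vertices block by block.

    neighbourInBlock : ∀ {B w b} → B ∈ˡ blocks → w ∈ B → b ∈ B → b ≢ w →
                       ∃ λ x → x ∈ B × w ~ x × Walk (⊤ - w) x b
    neighbourInBlock {B} {w} {b} B∈ w∈B b∈B b≢w with (_ , conn , conn-) , _ ← block B∈
      with conn w b w∈B b∈B
    ... | here _ = contradiction refl b≢w
    ... | step {v = x} _ w~x walk = x , x∈B , w~x , walk-mono (p-x⊆⊤-x w)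
          (conn- w w∈B x b (x∈p∧x≢y⇒x∈p-y x∈B (≢-sym (~⇒≢ w~x))) (x∈p∧x≢y⇒x∈p-y b∈B b≢w))
      where
      x∈B = walk-start walk

    -- Neighbours `x ∈ B` and `x′ ∈ B′` of `w` are joined through `S` without meeting `w`, so
    -- `link-closed` puts `x′` in `B`. The edge from `w` to `x′` then lies in both blocks, which
    -- forces `B′ ⊆ B`, and maximality of `B′` finishes.
    blocks-at-≡ : ∀ {S w B B′} → ConnectedIn G S → w ∉ S → B ∈ˡ blocks → B′ ∈ˡ blocks →
                  w ∈ B → w ∈ B′ → Nonempty (S ∩ B) → Nonempty (S ∩ B′) → B ≡ B′
    blocks-at-≡ {S} {w} {B} {B′} conn w∉S B∈ B′∈ w∈B w∈B′ (b , b∈) (b′ , b′∈) =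
      let b∈S , b∈B = x∈p∩q⁻ S B b∈
          b′∈S , b′∈B′ = x∈p∩q⁻ S B′ b′∈
          x  , x∈B   , w~x  , x⇝b   = neighbourInBlock B∈  w∈B  b∈B   λ { refl → w∉S b∈S }
          x′ , x′∈B′ , w~x′ , x′⇝b′ = neighbourInBlock B′∈ w∈B′ b′∈B′ λ { refl → w∉S b′∈S }
          closed = block-triangleClosed (block B∈)
          x⇝x′ = x⇝b ++ (walk-mono avoid (conn b b′ b∈S b′∈S) ++ walk-sym x′⇝b′)
          x′∈B = link-closed chordal closed w∈B x∈B w~x w~x′ x⇝x′
          B′⊆B = nonSeparable⊆ chordal closed (proj₁ (block B′∈)) w∈B′ x′∈B′ w∈B x′∈B w~x′
      in proj₂ (block B′∈) B B′⊆B (proj₁ (block B∈))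
      where
      avoid : S ⊆ ⊤ - w
      avoid z∈S = x∈p∧x≢y⇒x∈p-y ∈⊤ λ { refl → w∉S z∈S }

    -- Used with `k = 2` for closure steps along cycles and with `k = 1` for connected growth.
    -- Truncation lets a block count only once `S` has more than `k` vertices in it.
    excess : ℕ → Subset n → ℕ
    excess k S = sum (map (λ B → ∣ S ∩ B ∣ ∸ k) blocks)

    -- If the bound failed for `S`, then `S` would be convex: a new vertex `v` in `Icc G S` would
    -- transfer the bound from `S ∪ ⁅ v ⁆` back to `S`. A convex generating set is `⊤`.
    generates-excess : ∀ {S} → Generates S → n + excess 2 S ≤ ∣ S ∣ + excess 2 ⊤
    generates-excess = go (⊃-wellFounded _)
      where
      go : ∀ {S} → Acc _⊃_ S → Generates S → n + excess 2 S ≤ ∣ S ∣ + excess 2 ⊤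
      go {S} (acc larger) gen = decidable-stable (_ ≤? _) contra
        where
        contra : ¬ ¬ (n + excess 2 S ≤ ∣ S ∣ + excess 2 ⊤)
        contra fails with gen S id convex
          where
          convex : Convex G S
          convex v (inj₁ v∈S) = v∈S
          convex v (inj₂ (C , v∈C , v∉S , only)) = contradiction (≤-pred bound) fails
            where
            open CycleNeighbours (cycleNeighbours C v∈C)
            inS : ∀ {u} → OnCycle G C u → v ~ u → u ∈ S
            inS {u} u∈C v~u = decidable-stable (u ∈? S) λ u∉S → ~⇒≢ v~u (sym (only u u∈C u∉S))
            S⊂S′ = x∉p⇒p⊂p∪⁅x⁆ v∉S
            S⊆S′ = p⊂q⇒p⊆q S⊂S′
            gen′ : Generates (S ∪ ⁅ v ⁆)
            gen′ D S′⊆D = gen D (⊆-trans S⊆S′ S′⊆D)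
            vx⊆block = edge⊆block v~x
            B   = proj₁ vx⊆block
            B∈  = proj₁ (proj₂ vx⊆block)
            v∈B = proj₁ (proj₂ (proj₂ vx⊆block))
            x∈B = proj₂ (proj₂ (proj₂ vx⊆block))
            -- The rest of the cycle links `x` to `y` around `v`, so both neighbours lie in one
            -- block with `v`.
            y∈B = link-closed chordal (block-triangleClosed (block B∈)) v∈B x∈B v~x v~y x⇝y
            S∩B⊂S′∩B : S ∩ B ⊂ (S ∪ ⁅ v ⁆) ∩ B
            S∩B⊂S′∩B = ∩-monoˡ-⊆ B S⊆S′ , v , x∈p∩q⁺ (q⊆p∪q S ⁅ v ⁆ (x∈⁅x⁆ v) , v∈B) ,
                        v∉S ∘ proj₁ ∘ x∈p∩q⁻ S B
            excess< : excess 2 S < excess 2 (S ∪ ⁅ v ⁆)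
            excess< = sum-mono-<
              (λ {A} _ → ∸-monoˡ-≤ 2 (p⊆q⇒∣p∣≤∣q∣ (∩-monoˡ-⊆ A S⊆S′))) B∈
              -- `x` and `y` already lie in `S ∩ B`, so subtracting 2 does not truncate and the
              -- growth stays strict.
              (∸-monoˡ-< (p⊂q⇒∣p∣<∣q∣ S∩B⊂S′∩B)
                (x≢y⇒2≤∣p∣ (x∈p∩q⁺ (inS x∈C v~x , x∈B)) (x∈p∩q⁺ (inS y∈C v~y , y∈B)) x≢y))
            open ≤-Reasoning
            bound : suc (n + excess 2 S) ≤ suc (∣ S ∣ + excess 2 ⊤)
            bound = begin
              suc (n + excess 2 S)             ≡⟨ +-suc n _ ⟨
              n + suc (excess 2 S)             ≤⟨ +-monoʳ-≤ n excess< ⟩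
              n + excess 2 (S ∪ ⁅ v ⁆)         ≤⟨ go (larger S⊂S′) gen′ ⟩
              ∣ S ∪ ⁅ v ⁆ ∣ + excess 2 ⊤       ≤⟨ +-monoˡ-≤ _ (∣p∪⁅x⁆∣≤1+∣p∣ S v) ⟩
              suc (∣ S ∣ + excess 2 ⊤)         ∎
        -- At `⊤` both sides agree.
        ... | refl = fails (≤-reflexive (cong (_+ excess 2 ⊤) (sym (∣⊤∣≡n n))))

    -- At `⊤` the inequality bounds the sum of all `∣ B ∣ ∸ 1` strictly below `n`. Connectedness is
    -- carried along for `blocks-at-≡`.
    Spread : Subset n → Set
    Spread S = Nonempty S × ConnectedIn G S × excess 1 S < ∣ S ∣

    spread-singleton : ∀ c → Spread ⁅ c ⁆
    spread-singleton c = (c , x∈⁅x⁆ c) , connected-singleton (x∈⁅y⁆⇒x≡y c) ,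
      subst (excess 1 ⁅ c ⁆ <_) (sym (∣⁅x⁆∣≡1 c)) (s≤s excess≤0)
      where
      excess≤0 : excess 1 ⁅ c ⁆ ≤ 0
      excess≤0 = ≤-trans (sum-mono-≤ {g = λ _ → 0} blocks λ {B} _ →
          ∸-monoˡ-≤ 1 (≤-trans (∣p∩q∣≤∣p∣ ⁅ c ⁆ B) (≤-reflexive (∣⁅x⁆∣≡1 c))))
        (≤-reflexive (sum-zeros blocks))
        where
        sum-zeros : ∀ xs → sum (map (λ (_ : Subset n) → 0) xs) ≡ 0
        sum-zeros []       = refl
        sum-zeros (_ ∷ xs) = sum-zeros xs

    -- Only a block that contains `w` and meets `S` can gain, and `blocks-at-≡` leaves at most one
    -- such block. So `excess 1` rises by at most one while the size rises by one.
    spread-grow : ∀ {S} → Spread S → S ≢ ⊤ → ∃ λ S′ → S ⊂ S′ × Spread S′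
    spread-grow {S} ((c , c∈S) , conn , excess<) S≢⊤
      with u , w , u∈S , w∉S , u~w ← frontier connected c∈S S≢⊤ =
      S ∪ ⁅ w ⁆ , x∉p⇒p⊂p∪⁅x⁆ w∉S ,
      (c , p⊆p∪q ⁅ w ⁆ c∈S) , connected-∪⁅⁆ conn u∈S u~w ,
      ≤-trans (s≤s (≤-trans excess≤ excess<)) (p⊂q⇒∣p∣<∣q∣ (x∉p⇒p⊂p∪⁅x⁆ w∉S))
      where
      bump : ∀ B → ∣ (S ∪ ⁅ w ⁆) ∩ B ∣ ∸ 1 ≤ suc (∣ S ∩ B ∣ ∸ 1)
      bump B = ≤-trans
        (∸-monoˡ-≤ 1 (≤-trans (p⊆q⇒∣p∣≤∣q∣ sub) (∣p∪⁅x⁆∣≤1+∣p∣ (S ∩ B) w)))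
        (m≤n+m∸n ∣ S ∩ B ∣ 1)
        where
        sub : (S ∪ ⁅ w ⁆) ∩ B ⊆ (S ∩ B) ∪ ⁅ w ⁆
        sub x∈ with x∈∪ , x∈B ← x∈p∩q⁻ (S ∪ ⁅ w ⁆) B x∈ with x∈p∪q⁻ S ⁅ w ⁆ x∈∪
        ... | inj₁ x∈S = p⊆p∪q ⁅ w ⁆ (x∈p∩q⁺ (x∈S , x∈B))
        ... | inj₂ x∈w = q⊆p∪q (S ∩ B) ⁅ w ⁆ x∈w
      bumped : ∀ {B} → ∣ S ∩ B ∣ ∸ 1 < ∣ (S ∪ ⁅ w ⁆) ∩ B ∣ ∸ 1 → w ∈ B × Nonempty (S ∩ B)
      bumped {B} lt =
        decidable-stable (w ∈? B) (λ w∉B → <⇒≱ lt (∸-monoˡ-≤ 1 (p⊆q⇒∣p∣≤∣q∣ (off w∉B)))) ,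
        -- If `S` misses `B`, then `w` is at most the first vertex there, and the truncated term
        -- remains 0.
        decidable-stable (nonempty? (S ∩ B)) (λ empty → <⇒≱ lt (≤-trans (∸-monoˡ-≤ 1 (alone empty)) z≤n))
        where
        off : w ∉ B → (S ∪ ⁅ w ⁆) ∩ B ⊆ S ∩ B
        off w∉B x∈ with x∈∪ , x∈B ← x∈p∩q⁻ (S ∪ ⁅ w ⁆) B x∈ with x∈p∪q⁻ S ⁅ w ⁆ x∈∪
        ... | inj₁ x∈S = x∈p∩q⁺ (x∈S , x∈B)
        ... | inj₂ x∈w = contradiction (subst (_∈ B) (x∈⁅y⁆⇒x≡y w x∈w) x∈B) w∉B
        alone : ¬ Nonempty (S ∩ B) → ∣ (S ∪ ⁅ w ⁆) ∩ B ∣ ≤ 1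
        alone empty = ≤-trans (p⊆q⇒∣p∣≤∣q∣ sub) (≤-reflexive (∣⁅x⁆∣≡1 w))
          where
          sub : (S ∪ ⁅ w ⁆) ∩ B ⊆ ⁅ w ⁆
          sub x∈ with x∈∪ , x∈B ← x∈p∩q⁻ (S ∪ ⁅ w ⁆) B x∈ with x∈p∪q⁻ S ⁅ w ⁆ x∈∪
          ... | inj₁ x∈S = contradiction (_ , x∈p∩q⁺ (x∈S , x∈B)) empty
          ... | inj₂ x∈w = x∈w
      excess≤ : excess 1 (S ∪ ⁅ w ⁆) ≤ suc (excess 1 S)
      excess≤ = sum≤1+sum (proj₁ blockList) (λ {B} _ → bump B) λ B∈ B′∈ B> B′> →
        blocks-at-≡ conn w∉S B∈ B′∈ (proj₁ (bumped B>)) (proj₁ (bumped B′>))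
                                    (proj₂ (bumped B>)) (proj₂ (bumped B′>))

    -- Each block has at least two vertices, so `excess 1 ⊤` exceeds `excess 2 ⊤` by at least one
    -- per block. Chaining the two estimates lets `excess 2 ⊤` cancel.
    length-blocks<∣generates∣ : ∀ {S} → Generates S → length blocks < ∣ S ∣
    length-blocks<∣generates∣ {S} gen = +-cancelʳ-≤ (excess 2 ⊤) _ _ (begin
      suc (length blocks + excess 2 ⊤)  ≤⟨ s≤s (length+sum-mono-≤ blocks excess-gap) ⟩
      suc (excess 1 ⊤)                  ≤⟨ proj₂ (proj₂ (⊂-grow Spread spread-grow (spread-singleton root))) ⟩
      ∣ ⊤ {n} ∣                         ≡⟨ ∣⊤∣≡n n ⟩
      n                                 ≤⟨ m≤m+n n _ ⟩
      n + excess 2 S                    ≤⟨ generates-excess gen ⟩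
      ∣ S ∣ + excess 2 ⊤                ∎)
      where
      open ≤-Reasoning
      excess-gap : ∀ {B} → B ∈ˡ blocks → ∣ ⊤ ∩ B ∣ ∸ 2 < ∣ ⊤ ∩ B ∣ ∸ 1
      excess-gap {B} B∈ rewrite ∩-identityˡ B = ∸-suc (2≤∣block∣ B∈)
        where
        ∸-suc : ∀ {m} → 2 ≤ m → m ∸ 2 < m ∸ 1
        ∸-suc (s≤s (s≤s _)) = ≤-refl

    -- Upper bound: spanning the graph block by block.

    missed : Subset n → Subset n → ℕ
    missed H B = if does (B ⊆? H) then 0 else 1

    missed-⊆ : ∀ {H B} → B ⊆ H → missed H B ≡ 0
    missed-⊆ {H} {B} B⊆H rewrite dec-true (B ⊆? H) B⊆H = refl

    missed-⊈ : ∀ {H B} → ¬ B ⊆ H → missed H B ≡ 1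
    missed-⊈ {H} {B} B⊈H rewrite dec-false (B ⊆? H) B⊈H = refl

    missed≤1 : ∀ H B → missed H B ≤ 1
    missed≤1 H B with does (B ⊆? H)
    ... | true  = z≤n
    ... | false = ≤-refl

    missed-antitone : ∀ {H H′ B} → H ⊆ H′ → missed H′ B ≤ missed H B
    missed-antitone {H} {H′} {B} H⊆H′ with B ⊆? H
    ... | yes B⊆H = ≤-reflexive (missed-⊆ (⊆-trans B⊆H H⊆H′))
    ... | no  _   = missed≤1 H′ B

    -- The inequality is a budget: after the first vertex, every vertex put into `S` is paid for by
    -- a block newly absorbed into `H`. The last clause says that `H` lies in the hull of `S`.
    CheaplySpanned : Subset n → Set
    CheaplySpanned H = Nonempty H × ∃ λ S →
      ∣ S ∣ + sum (map (missed H) blocks) ≤ suc (length blocks) ×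
      (∀ C → S ⊆ C → Convex G C → H ⊆ C)

    cheaplySpanned-singleton : ∀ c → CheaplySpanned ⁅ c ⁆
    cheaplySpanned-singleton c = (c , x∈⁅x⁆ c) , ⁅ c ⁆ ,
      +-mono-≤ (≤-reflexive (∣⁅x⁆∣≡1 c)) (bound blocks) , λ _ c⊆C _ → c⊆C
      where
      bound : ∀ bs → sum (map (missed ⁅ c ⁆) bs) ≤ length bs
      bound []       = z≤n
      bound (B ∷ bs) = +-mono-≤ (missed≤1 ⁅ c ⁆ B) (bound bs)

    -- A convex set containing `S` and `w` contains `H`, hence the edge from `u` to `w`, hence by
    -- `nonSeparable⊆` the whole block `B`.
    cheaplySpanned-grow : ∀ {H} → CheaplySpanned H → H ≢ ⊤ → ∃ λ H′ → H ⊂ H′ × CheaplySpanned H′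
    cheaplySpanned-grow {H} ((c , c∈H) , S , cost , spans) H≢⊤
      with u , w , u∈H , w∉H , u~w ← frontier connected c∈H H≢⊤
      with B , B∈ , u∈B , w∈B ← edge⊆block u~w =
      H ∪ B , (p⊆p∪q B , w , q⊆p∪q H B w∈B , w∉H) , (c , p⊆p∪q B c∈H) , S ∪ ⁅ w ⁆ , cost′ , spans′
      where
      missed< : sum (map (missed (H ∪ B)) blocks) < sum (map (missed H) blocks)
      missed< = sum-mono-< (λ {A} _ → missed-antitone {B = A} (p⊆p∪q B)) B∈
        -- The term of `B` drops from 1 to 0, since `w` kept `B` from lying in `H`.
        (subst₂ _<_ (sym (missed-⊆ (q⊆p∪q H B))) (sym (missed-⊈ λ B⊆H → w∉H (B⊆H w∈B))) ≤-refl)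
      open ≤-Reasoning
      cost′ = begin
        ∣ S ∪ ⁅ w ⁆ ∣ + sum (map (missed (H ∪ B)) blocks)  ≤⟨ +-monoˡ-≤ _ (∣p∪⁅x⁆∣≤1+∣p∣ S w) ⟩
        suc ∣ S ∣ + sum (map (missed (H ∪ B)) blocks)      ≡⟨ +-suc ∣ S ∣ _ ⟨
        ∣ S ∣ + suc (sum (map (missed (H ∪ B)) blocks))    ≤⟨ +-monoʳ-≤ ∣ S ∣ missed< ⟩
        ∣ S ∣ + sum (map (missed H) blocks)                ≤⟨ cost ⟩
        suc (length blocks)                                ∎
      spans′ : ∀ C → S ∪ ⁅ w ⁆ ⊆ C → Convex G C → H ∪ B ⊆ C
      spans′ C S′⊆C convex x∈ =
        [ H⊆C , nonSeparable⊆ chordal (convex⇒triangleClosed convex) (proj₁ (block B∈))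
                  u∈B w∈B (H⊆C u∈H) (S′⊆C (q⊆p∪q S ⁅ w ⁆ (x∈⁅x⁆ w))) u~w ]′
        (x∈p∪q⁻ H B x∈)
        where
        H⊆C : H ⊆ C
        H⊆C = spans C (⊆-trans (p⊆p∪q ⁅ w ⁆) S′⊆C) convex

    hullNumber≡1+length-blocks : HullNumber≡ G (suc (length blocks))
    hullNumber≡1+length-blocks
      with _ , S , cost , spans ← ⊂-grow CheaplySpanned cheaplySpanned-grow (cheaplySpanned-singleton root) =
      -- The budget at `⊤` bounds `∣ S ∣` from above; the lower bound applied to `S` itself gives
      -- equality.
      (S , generates⇒hullSet gen , ≤-antisym (≤-trans (m≤m+n ∣ S ∣ _) cost) (length-blocks<∣generates∣ gen)) ,
      λ S′ hull → length-blocks<∣generates∣ (hullSet⇒generates hull)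
      where
      gen : Generates S
      gen C S⊆C convex = ⊆-antisym ⊆⊤ (spans C S⊆C convex)

theorem2 : (n : ℕ) → 2 ≤ n → (G : Graph n) → Connected G → Chordal G →
    (blocks : List (Subset n)) → BlockList G blocks →
    HullNumber≡ G (suc (length blocks))
theorem2 _ 2≤n G connected chordal = hullNumber≡1+length-blocks G 2≤n connected chordal
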